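{- The minimum size $f(d)$ of a double cover of $\{0,1,2\}^d$ satisfies $f(4)\ge 19>16=2^4$ and $f(5)\ge 33>32=2^5$. In particular $f(d)\ge 2^d$ holds for $d=4$ and $d=5$.
   Context: Write $[3]=\{0,1,2\}$. A proper sub-box of $[3]^d$ is a set $B=S_1\times\dots\times S_d$ with $\varnothing\neq S_i\subsetneq[3]$ for every $1\le i\le d$ (so each side $S_i$ has one or two elements). A double cover of $[3]^d$ is a finite multiset $\{B_1,\dots,B_m\}$ of proper sub-boxes such that every point of $[3]^d$ lies in exactly two of the $B_j$, counted with multiplicity; its size is $m$. $f(d)$ denotes the minimum size of a double cover of $[3]^d$. The base value $f(3)=11$ is taken as known (it is established by exhaustive computation). -}

module Defs where

open import Data.Empty using (⊥-elim)
open import Data.Fin using (Fin; zero; suc)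
open import Data.Fin.Properties using (any?)
open import Data.Fin.Subset using (Subset; inside; outside; ⊤; _∈_; _⊂_; Nonempty)
open import Data.Fin.Subset.Properties using (_∈?_; _⊂?_; nonempty?; anySubset?; ⊆⊤; ∈⊤)
open import Data.List using (List; []; _∷_; _++_; length; map; filter)
open import Data.List.Properties using (length-++; filter-++)
open import Data.List.Relation.Unary.All as ListAll using ([]; _∷_)
open import Data.List.Relation.Unary.All.Properties using (++⁺; map⁺)
open import Data.Nat using (ℕ; zero; suc; _+_; _≤_; z≤n; s≤s)
open import Data.Nat.Properties using (_≟_)
open import Data.Product using (∃; ∃-syntax; _×_; _,_; proj₁; proj₂)
open import Data.Vec using (Vec; []; _∷_; here; there)
open import Data.Vec.Relation.Binary.Pointwise.Inductive as Pointwise using (Pointwise; []; _∷_)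
open import Data.Vec.Relation.Unary.All as VecAll using ([]; _∷_)
open import Level using (0ℓ)
open import Relation.Binary.PropositionalEquality using (_≡_; refl; trans; cong; cong₂)
open import Relation.Nullary using (Dec; yes; no; ¬_)
open import Relation.Nullary.Decidable using (map′; _×-dec_; ¬?; decidable-stable)
open import Relation.Unary using (Pred; Decidable)

Point : ℕ → Set
Point d = Vec (Fin 3) d

-- The vector of sides S₁, …, S_d stands for the set S₁ × ⋯ × S_d.  For
-- nonempty sides the set determines the vector, so distinct proper boxes
-- here are distinct sets.
Box : ℕ → Set
Box d = Vec (Subset 3) d

Proper : ∀ {d} → Box d → Set
Proper = VecAll.All (λ S → Nonempty S × S ⊂ ⊤)

infix 4 _∈ᵇ_ _∈ᵇ?_

_∈ᵇ_ : ∀ {d} → Point d → Box d → Set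
_∈ᵇ_ = Pointwise _∈_

_∈ᵇ?_ : ∀ {d} (x : Point d) (B : Box d) → Dec (x ∈ᵇ B)
_∈ᵇ?_ = Pointwise.decidable _∈?_

multiplicity : ∀ {d} → Point d → List (Box d) → ℕ
multiplicity x Bs = length (filter (x ∈ᵇ?_) Bs)

-- A finite multiset of boxes is represented by a list; the order of the
-- entries affects neither this predicate nor the size, which is the length.
DoubleCover : ∀ {d} → List (Box d) → Set
DoubleCover {d} Bs = ListAll.All Proper Bs × ((x : Point d) → multiplicity x Bs ≡ 2)

HasDoubleCover : ℕ → ℕ → Set
HasDoubleCover d m = ∃[ Bs ] DoubleCover {d} Bs × length Bs ≡ m

IsMinimum : Pred ℕ 0ℓ → ℕ → Set
IsMinimum P m = P m × (∀ k → P k → m ≤ k)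

-- The rest constructs the minimum: the possible sizes form a decidable set
-- (finite search) which is inhabited (every box of a partition of [3]^d into
-- 2^d proper boxes, taken twice).

private

  Searchable : Set → Set₁
  Searchable A = ∀ {P : Pred A 0ℓ} → Decidable P → Dec (∃ P)

  searchVec : ∀ {A} → Searchable A → ∀ n → Searchable (Vec A n)
  searchVec s zero    P? = map′ ([] ,_) (λ { ([] , p) → p }) (P? [])
  searchVec s (suc n) P? =
    map′ (λ { (x , xs , p) → x ∷ xs , p }) (λ { (x ∷ xs , p) → x , xs , p })
         (s (λ x → searchVec s n (λ xs → P? (x ∷ xs))))

  searchList : ∀ {A} → Searchable A → ∀ m {P : Pred (List A) 0ℓ} → Decidable P →
               Dec (∃[ xs ] P xs × length xs ≡ m)
  searchList s zero    P? =
    map′ (λ p → [] , p , refl) (λ { ([] , p , _) → p }) (P? [])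
  searchList s (suc m) P? =
    map′ (λ { (x , xs , p , refl) → x ∷ xs , p , refl })
         (λ { (x ∷ xs , p , refl) → x , xs , p , refl })
         (s (λ x → searchList s m (λ xs → P? (x ∷ xs))))

  universal? : ∀ {A} → Searchable A → {P : Pred A 0ℓ} → Decidable P → Dec (∀ x → P x)
  universal? s P? =
    map′ (λ ¬∃ x → decidable-stable (P? x) (λ ¬p → ¬∃ (x , ¬p)))
         (λ ∀p (x , ¬p) → ¬p (∀p x))
         (¬? (s (λ x → ¬? (P? x))))

  doubleCover? : ∀ {d} → Decidable (DoubleCover {d})
  doubleCover? {d} Bs =
    ListAll.all? (VecAll.all? (λ S → nonempty? S ×-dec (S ⊂? ⊤))) Bs
    ×-dec universal? (searchVec any? d) (λ x → multiplicity x Bs ≟ 2)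

  hasDoubleCover? : ∀ d → Decidable (HasDoubleCover d)
  hasDoubleCover? d m = searchList (searchVec anySubset? d) m doubleCover?

  least : ∀ n {P : Pred ℕ 0ℓ} → Decidable P → P n → ∃ (IsMinimum P)
  least zero P? p = 0 , p , λ _ _ → z≤n
  least (suc n) P? p with P? 0
  ... | yes p₀ = 0 , p₀ , λ _ _ → z≤n
  ... | no ¬p₀ with least n (λ k → P? (suc k)) p
  ...   | m , q , min =
    suc m , q , λ { zero p₀ → ⊥-elim (¬p₀ p₀) ; (suc k) r → s≤s (min k r) }

  ⟦0⟧ ⟦12⟧ : Subset 3
  ⟦0⟧  = inside ∷ outside ∷ outside ∷ []
  ⟦12⟧ = outside ∷ inside ∷ inside ∷ []

  partition : ∀ d → List (Box d)
  partition zero    = [] ∷ []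
  partition (suc d) = map (⟦0⟧ ∷_) (partition d) ++ map (⟦12⟧ ∷_) (partition d)

  partition-proper : ∀ d → ListAll.All Proper (partition d)
  partition-proper zero    = [] ∷ []
  partition-proper (suc d) =
    ++⁺ (map⁺ (ListAll.map (((zero , here) , ⊆⊤ , suc zero , ∈⊤ , λ { (there ()) }) ∷_) ih))
        (map⁺ (ListAll.map (((suc zero , there here) , ⊆⊤ , zero , ∈⊤ , λ ()) ∷_) ih))
    where ih = partition-proper d

  multiplicity-++ : ∀ {d} (x : Point d) Bs Cs →
                    multiplicity x (Bs ++ Cs) ≡ multiplicity x Bs + multiplicity x Cs
  multiplicity-++ x Bs Cs =
    trans (cong length (filter-++ (x ∈ᵇ?_) Bs Cs)) (length-++ (filter (x ∈ᵇ?_) Bs))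

  multiplicity-∈ : ∀ {d i S} (x : Point d) → i ∈ S → ∀ Bs →
                   multiplicity (i ∷ x) (map (S ∷_) Bs) ≡ multiplicity x Bs
  multiplicity-∈ x i∈S [] = refl
  multiplicity-∈ {i = i} {S} x i∈S (B ∷ Bs) with i ∈? S | x ∈ᵇ? B
  ... | yes _  | yes _ = cong suc (multiplicity-∈ x i∈S Bs)
  ... | yes _  | no  _ = multiplicity-∈ x i∈S Bs
  ... | no i∉S | _     = ⊥-elim (i∉S i∈S)

  multiplicity-∉ : ∀ {d i S} (x : Point d) → ¬ i ∈ S → ∀ (Bs : List (Box d)) →
                   multiplicity (i ∷ x) (map (S ∷_) Bs) ≡ 0
  multiplicity-∉ x i∉S [] = refl
  multiplicity-∉ {i = i} {S} x i∉S (B ∷ Bs) with i ∈? S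
  ... | yes i∈S = ⊥-elim (i∉S i∈S)
  ... | no _    = multiplicity-∉ x i∉S Bs

  partition-multiplicity : ∀ d (x : Point d) → multiplicity x (partition d) ≡ 1
  partition-multiplicity zero    []      = refl
  partition-multiplicity (suc d) (i ∷ x) =
    trans (multiplicity-++ (i ∷ x) (map (⟦0⟧ ∷_) (partition d)) _) (halves i)
    where
    ih = partition-multiplicity d x
    in₁ : ∀ {i S} → i ∈ S → multiplicity (i ∷ x) (map (S ∷_) (partition d)) ≡ 1
    in₁ i∈S = trans (multiplicity-∈ x i∈S (partition d)) ih
    out : ∀ {i S} → ¬ i ∈ S → multiplicity (i ∷ x) (map (S ∷_) (partition d)) ≡ 0
    out i∉S = multiplicity-∉ x i∉S (partition d)
    halves : ∀ i → multiplicity (i ∷ x) (map (⟦0⟧ ∷_) (partition d))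
                 + multiplicity (i ∷ x) (map (⟦12⟧ ∷_) (partition d)) ≡ 1
    halves zero             = cong₂ _+_ (in₁ here) (out λ ())
    halves (suc zero)       = cong₂ _+_ (out λ { (there ()) }) (in₁ (there here))
    halves (suc (suc zero)) =
      cong₂ _+_ (out λ { (there (there ())) }) (in₁ (there (there here)))

  doubleCover-exists : ∀ d → ∃ (HasDoubleCover d)
  doubleCover-exists d =
    _ , partition d ++ partition d
      , (++⁺ (partition-proper d) (partition-proper d)
        , λ x → trans (multiplicity-++ x (partition d) _)
                      (cong₂ _+_ (partition-multiplicity d x) (partition-multiplicity d x)))
      , refl

  minimum : ∀ d → ∃ (IsMinimum (HasDoubleCover d))
  minimum d = least _ (hasDoubleCover? d) (proj₂ (doubleCover-exists d))

-- Opaque so that the type checker never runs the search.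
opaque

  f : ℕ → ℕ
  f d = proj₁ (minimum d)

  f-isMinimum : ∀ d → IsMinimum (HasDoubleCover d) (f d)
  f-isMinimum d = proj₂ (minimum d)

-- Let s be the number of one-element sides of a proper box B of [3]ᵈ.  Then
-- |B| = 2ᵈ⁻ˢ, and (3 − s) 2ˢ ≤ 4 gives 2ᵈ (3 − s) ≤ 4 |B|.  Sum this over a double
-- cover of size m: the volumes |B| add up to 2 · 3ᵈ, and since s = 2d − Σᵢ |Sᵢ|, the
-- total number of one-element sides is 2dm minus the sum of the sizes of all slices
-- { B : a ∈ Sᵢ }.  Each of these 3d slices is a double cover of [3]ᵈ⁻¹, so it has
-- size at least f(d − 1), and therefore
--   2ᵈ (3m + 3d f(d − 1)) ≤ 8 · 3ᵈ + 2ᵈ · 2dm.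
module Submission where

open import Defs
import Algebra.Properties.CommutativeMonoid.Sum
open import Data.Bool using (if_then_else_)
open import Data.Fin using (Fin; zero; suc)
open import Data.Fin.Subset using (Subset; inside; outside; ⊤; _⊂_; Nonempty; ∣_∣)
  renaming (_∈_ to _∈ˢ_)
open import Data.Fin.Subset.Properties using (_∈?_; x∈p⇒∣p-x∣<∣p∣; p⊂q⇒∣p∣<∣q∣)
open import Data.List using (List; []; _∷_; length; map; filter)
open import Data.List.Relation.Unary.All as ListAll using ([]; _∷_)
import Data.List.Relation.Unary.All.Properties as ListAll
open import Data.Nat using (ℕ; zero; suc; _+_; _*_; _∸_; _^_; _≤_; _≥_; _>_; z≤n; s≤s; _≤?_)
open import Data.Nat.ListAction using (sum)
open import Data.Nat.Properties
open import Data.Nat.Tactic.RingSolver using (solve-∀)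
open import Data.Product using (_×_; _,_; proj₁; proj₂; ∃-syntax)
open import Data.Sum using (_⊎_; inj₁; inj₂)
open import Data.Vec using ([]; _∷_; lookup; insertAt; removeAt)
open import Data.Vec.Relation.Binary.Pointwise.Inductive using ([]; _∷_)
open import Data.Vec.Relation.Unary.All using ([]; _∷_)
open import Function using (_∘_; _⇔_; mk⇔; Equivalence)
open import Relation.Binary.PropositionalEquality using (_≡_; refl; sym; trans; cong; cong₂; module ≡-Reasoning)
open import Relation.Nullary using (yes; no; does; contradiction)
open import Relation.Nullary.Decidable using (from-yes)

open Algebra.Properties.CommutativeMonoid.Sum +-0-commutativeMonoid
  using (sum-syntax; ∑-distrib-+; sum-cong-≗; sum-replicate-zero)

-- Finite sums and weighted sums over lists.

∑-indicator : ∀ {n} (p : Subset n) c →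
              ∑[ a < n ] (if does (a ∈? p) then c else 0) ≡ ∣ p ∣ * c
∑-indicator []            c = refl
∑-indicator (inside ∷ p)  c = cong (c +_) (∑-indicator p c)
∑-indicator (outside ∷ p) c = ∑-indicator p c

∑-lower : ∀ {n c} {t : Fin n → ℕ} → (∀ i → c ≤ t i) → n * c ≤ ∑[ i < n ] t i
∑-lower {zero}  c≤t = z≤n
∑-lower {suc n} c≤t = +-mono-≤ (c≤t zero) (∑-lower (c≤t ∘ suc))

module _ {A : Set} where

  total : (A → ℕ) → List A → ℕ
  total w xs = sum (map w xs)

  total-1 : ∀ xs → total (λ _ → 1) xs ≡ length xs
  total-1 []       = refl
  total-1 (x ∷ xs) = cong suc (total-1 xs)

  total-cong : ∀ {v w : A → ℕ} → (∀ x → v x ≡ w x) → ∀ xs → total v xs ≡ total w xs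
  total-cong v≗w []       = refl
  total-cong v≗w (x ∷ xs) = cong₂ _+_ (v≗w x) (total-cong v≗w xs)

  total-∑ : ∀ n (w : A → Fin n → ℕ) xs →
            total (λ x → ∑[ i < n ] w x i) xs ≡ ∑[ i < n ] total (λ x → w x i) xs
  total-∑ n w []       = sym (sum-replicate-zero n)
  total-∑ n w (x ∷ xs) =
    trans (cong (∑[ i < n ] w x i +_) (total-∑ n w xs)) (sym (∑-distrib-+ (w x) _))

-- Volume, girth and slices.

volume : ∀ {d} → Box d → ℕ
volume []      = 1
volume (S ∷ B) = ∣ S ∣ * volume B

-- For a proper box this is `2 * d` minus the number of one-element sides, so bounds on it count
-- such sides without subtraction.
girth : ∀ {d} → Box d → ℕ
girth {d} B = ∑[ i < d ] ∣ lookup B i ∣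

-- Boxes that become equal once side `i` is dropped stay separate entries, as multiplicities
-- require.
slice : ∀ {d} → Fin (suc d) → Fin 3 → List (Box (suc d)) → List (Box d)
slice i a Bs = map (λ B → removeAt B i) (filter (λ B → a ∈? lookup B i) Bs)

total-slice-∷ : ∀ {d} (w : Box d → ℕ) i a B Bs →
  total w (slice i a (B ∷ Bs)) ≡
  (if does (a ∈? lookup B i) then w (removeAt B i) else 0) + total w (slice i a Bs)
total-slice-∷ w i a B Bs with a ∈? lookup B i
... | yes _ = refl
... | no  _ = refl

-- Double counting: each `B` in `Bs` enters `slice i a Bs` for exactly `∣ lookup B i ∣` values of
-- `a`. The weight `volume` serves the volume count, the constant weight 1 the sizes of the slices.
∑-slice : ∀ {d} (w : Box d → ℕ) i Bs →
  ∑[ a < 3 ] total w (slice i a Bs) ≡ total (λ B → ∣ lookup B i ∣ * w (removeAt B i)) Bs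
∑-slice w i []       = refl
∑-slice w i (B ∷ Bs) = begin
  ∑[ a < 3 ] total w (slice i a (B ∷ Bs))
    ≡⟨ sum-cong-≗ (λ a → total-slice-∷ w i a B Bs) ⟩
  ∑[ a < 3 ] (indicator a + total w (slice i a Bs))
    ≡⟨ ∑-distrib-+ indicator (λ a → total w (slice i a Bs)) ⟩
  ∑[ a < 3 ] indicator a + ∑[ a < 3 ] total w (slice i a Bs)
    ≡⟨ cong₂ _+_ (∑-indicator (lookup B i) _) (∑-slice w i Bs) ⟩
  total (λ B → ∣ lookup B i ∣ * w (removeAt B i)) (B ∷ Bs) ∎
  where
  open ≡-Reasoning
  indicator : Fin 3 → ℕ
  indicator a = if does (a ∈? lookup B i) then w (removeAt B i) else 0

-- Slices of double covers are double covers.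

∈ᵇ-insertAt : ∀ {d} (x : Point d) i a (B : Box (suc d)) →
              insertAt x i a ∈ᵇ B ⇔ (a ∈ˢ lookup B i × x ∈ᵇ removeAt B i)
∈ᵇ-insertAt x zero a (S ∷ B) = mk⇔
  (λ { (a∈S ∷ x∈B) → a∈S , x∈B })
  (λ (a∈S , x∈B) → a∈S ∷ x∈B)
∈ᵇ-insertAt (b ∷ x) (suc i) a (S ∷ B@(_ ∷ _)) = mk⇔
  (λ { (b∈S ∷ p) → let (a∈ , x∈) = Equivalence.to ih p in a∈ , b∈S ∷ x∈ })
  (λ { (a∈ , b∈S ∷ x∈) → b∈S ∷ Equivalence.from ih (a∈ , x∈) })
  where ih = ∈ᵇ-insertAt x i a B

-- The boxes of the slice that contain `x` come one for one from the boxes of `Bs` that contain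
-- `insertAt x i a`. Hence slicing preserves constant multiplicity.
multiplicity-slice : ∀ {d} (x : Point d) i a Bs →
                     multiplicity x (slice i a Bs) ≡ multiplicity (insertAt x i a) Bs
multiplicity-slice x i a [] = refl
multiplicity-slice x i a (B ∷ Bs)
  with ih ← multiplicity-slice x i a Bs
     | equiv ← ∈ᵇ-insertAt x i a B
     | a ∈? lookup B i | insertAt x i a ∈ᵇ? B
... | no  a∉ | no  _ = ih
... | no  a∉ | yes p = contradiction (proj₁ (Equivalence.to equiv p)) a∉
... | yes a∈ | q with x ∈ᵇ? removeAt B i | q
...   | yes _  | yes _ = cong suc ih
...   | yes x∈ | no ¬p = contradiction (Equivalence.from equiv (a∈ , x∈)) ¬p
...   | no  x∉ | yes p = contradiction (proj₂ (Equivalence.to equiv p)) x∉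
...   | no  _  | no  _ = ih

proper-removeAt : ∀ {d} i {B : Box (suc d)} → Proper B → Proper (removeAt B i)
proper-removeAt zero                    (_ ∷ ps) = ps
proper-removeAt (suc i) {_ ∷ _ ∷ _} (p ∷ ps) = p ∷ proper-removeAt i ps

doubleCover-slice : ∀ {d} i a {Bs : List (Box (suc d))} →
                    DoubleCover Bs → DoubleCover (slice i a Bs)
doubleCover-slice i a {Bs} (proper , twice) =
  ListAll.map⁺ (ListAll.map (proper-removeAt i) (ListAll.filter⁺ (λ B → a ∈? lookup B i) proper)) ,
  λ x → trans (multiplicity-slice x i a Bs) (twice (insertAt x i a))

-- Total volume and total girth of a cover.

multiplicity-[] : ∀ Bs → multiplicity [] Bs ≡ length Bs
multiplicity-[] []        = refl
multiplicity-[] ([] ∷ Bs) = cong suc (multiplicity-[] Bs)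

-- This counts incidences of points and boxes by induction on `d`: the three slices along the first
-- coordinate again have constant multiplicity `k`, and their volumes weighted by `∑-slice` add up
-- to the total.
total-volume : ∀ {d k} (Bs : List (Box d)) → (∀ x → multiplicity x Bs ≡ k) →
               total volume Bs ≡ 3 ^ d * k
total-volume {zero} {k} Bs cover = begin
  total volume Bs      ≡⟨ total-cong (λ { [] → refl }) Bs ⟩
  total (λ _ → 1) Bs   ≡⟨ total-1 Bs ⟩
  length Bs            ≡⟨ multiplicity-[] Bs ⟨
  multiplicity [] Bs   ≡⟨ cover [] ⟩
  k                    ≡⟨ +-identityʳ k ⟨
  3 ^ 0 * k            ∎
  where open ≡-Reasoning
total-volume {suc d} {k} Bs cover = begin
  total volume Bs
    ≡⟨ total-cong (λ { (_ ∷ _) → refl }) Bs ⟩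
  total (λ B → ∣ lookup B zero ∣ * volume (removeAt B zero)) Bs
    ≡⟨ ∑-slice volume zero Bs ⟨
  ∑[ a < 3 ] total volume (slice zero a Bs)
    ≡⟨ sum-cong-≗ (λ a → total-volume (slice zero a Bs)
                             (λ x → trans (multiplicity-slice x zero a Bs) (cover (a ∷ x)))) ⟩
  3 * (3 ^ d * k)
    ≡⟨ *-assoc 3 (3 ^ d) k ⟨
  3 ^ suc d * k ∎
  where open ≡-Reasoning

f≤length : ∀ {d} {Bs : List (Box d)} → DoubleCover Bs → f d ≤ length Bs
f≤length {d} {Bs} cover = proj₂ (f-isMinimum d) _ (Bs , cover , refl)

-- For fixed `i`, the sizes `∣ lookup B i ∣` add up to the sizes of the three slices in direction
-- `i`. Each slice is a double cover one dimension lower, so it has at least `f d` boxes.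
total-girth : ∀ {d} {Bs : List (Box (suc d))} → DoubleCover Bs →
              suc d * (3 * f d) ≤ total girth Bs
total-girth {d} {Bs} cover = begin
  suc d * (3 * f d)                                ≤⟨ ∑-lower side ⟩
  ∑[ i < suc d ] total (λ B → ∣ lookup B i ∣) Bs    ≡⟨ total-∑ (suc d) (λ B i → ∣ lookup B i ∣) Bs ⟨
  total girth Bs                                   ∎
  where
  open ≤-Reasoning
  side : ∀ i → 3 * f d ≤ total (λ B → ∣ lookup B i ∣) Bs
  side i = begin
    3 * f d                                     ≤⟨ ∑-lower (λ a → f≤length (doubleCover-slice i a cover)) ⟩
    ∑[ a < 3 ] length (slice i a Bs)            ≡⟨ sum-cong-≗ (λ a → total-1 (slice i a Bs)) ⟨
    ∑[ a < 3 ] total (λ _ → 1) (slice i a Bs)   ≡⟨ ∑-slice (λ _ → 1) i Bs ⟩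
    total (λ B → ∣ lookup B i ∣ * 1) Bs         ≡⟨ total-cong (λ B → *-identityʳ _) Bs ⟩
    total (λ B → ∣ lookup B i ∣) Bs             ∎

-- Girth against volume for proper boxes.

proper-side : ∀ {S : Subset 3} → Nonempty S → S ⊂ ⊤ → ∣ S ∣ ≡ 1 ⊎ ∣ S ∣ ≡ 2
proper-side {S} (x , x∈S) S⊂⊤
  -- Removing `x` lowers the size, so it is positive; strict inclusion in `⊤` makes it less than 3.
  with ∣ S ∣ | ≤-<-trans z≤n (x∈p⇒∣p-x∣<∣p∣ x∈S) | p⊂q⇒∣p∣<∣q∣ S⊂⊤
... | 1 | _ | _ = inj₁ refl
... | 2 | _ | _ = inj₂ refl
... | suc (suc (suc _)) | _ | s≤s (s≤s (s≤s ()))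

-- The witness `s` counts the one-element sides. Every side contributes 2 to `girth B + s` and a
-- factor 2 to `volume B * 2 ^ s`: as `1 + 1` and `1 * 2` if it has one element, as `2 + 0` and
-- `2 * 1` if it has two.
singletonSides : ∀ {d} {B : Box d} → Proper B →
                 ∃[ s ] girth B + s ≡ 2 * d × volume B * 2 ^ s ≡ 2 ^ d
singletonSides [] = 0 , refl , refl
singletonSides {suc d} {S ∷ B} ((nonempty , S⊂⊤) ∷ ps)
  with s , girth≡ , volume≡ ← singletonSides ps
  with ∣ S ∣ | proper-side nonempty S⊂⊤
... | _ | inj₁ refl = suc s ,
  trans (girth-step (girth B) s) (trans (cong (2 +_) girth≡) (sym (*-suc 2 d))) ,
  trans (volume-step (volume B) (2 ^ s)) (cong (2 *_) volume≡)
  where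
  girth-step : ∀ g s → 1 + g + suc s ≡ 2 + (g + s)
  girth-step = solve-∀
  volume-step : ∀ v t → 1 * v * (2 * t) ≡ 2 * (v * t)
  volume-step = solve-∀
... | _ | inj₂ refl = s ,
  trans (cong (2 +_) girth≡) (sym (*-suc 2 d)) ,
  trans (*-assoc 2 (volume B) (2 ^ s)) (cong (2 *_) volume≡)

-- The line `3 - s` meets the convex function `4 / 2 ^ s` at `s = 1` and `s = 2`, hence lies below
-- it at all other naturals; from `s = 3` on the truncated difference is 0.
[3∸s]*2^s≤4 : ∀ s → (3 ∸ s) * 2 ^ s ≤ 4
[3∸s]*2^s≤4 0 = from-yes (3 ≤? 4)
[3∸s]*2^s≤4 1 = ≤-refl
[3∸s]*2^s≤4 2 = ≤-refl
[3∸s]*2^s≤4 (suc (suc (suc s))) rewrite 0∸n≡0 s = z≤n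

-- The inequality 2ᵈ (3 − s) ≤ 4 |B| with s = 2d − girth B, moved so that no
-- subtraction occurs.
girth-volume : ∀ {d} {B : Box d} → Proper B →
               2 ^ d * (3 + girth B) ≤ 4 * volume B + 2 ^ d * (2 * d)
girth-volume {d} {B} proper with s , girth≡ , volume≡ ← singletonSides proper = begin
  2 ^ d * (3 + girth B)
    ≤⟨ *-monoʳ-≤ (2 ^ d) (+-monoˡ-≤ (girth B) (m≤n+m∸n 3 s)) ⟩
  2 ^ d * (s + (3 ∸ s) + girth B)
    ≡⟨ rearrange (2 ^ d) s (3 ∸ s) (girth B) ⟩
  (3 ∸ s) * 2 ^ d + 2 ^ d * (girth B + s)
    ≡⟨ cong₂ (λ p q → (3 ∸ s) * p + 2 ^ d * q) (sym volume≡) girth≡ ⟩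
  (3 ∸ s) * (volume B * 2 ^ s) + 2 ^ d * (2 * d)
    ≡⟨ cong (_+ 2 ^ d * (2 * d)) (swap (3 ∸ s) (volume B) (2 ^ s)) ⟩
  (3 ∸ s) * 2 ^ s * volume B + 2 ^ d * (2 * d)
    ≤⟨ +-monoˡ-≤ (2 ^ d * (2 * d)) (*-monoˡ-≤ (volume B) ([3∸s]*2^s≤4 s)) ⟩
  4 * volume B + 2 ^ d * (2 * d) ∎
  where
  open ≤-Reasoning
  rearrange : ∀ c s t g → c * (s + t + g) ≡ t * c + c * (g + s)
  rearrange = solve-∀
  swap : ∀ t v u → t * (v * u) ≡ t * u * v
  swap = solve-∀

total-girth-volume : ∀ {d} {Bs : List (Box d)} → ListAll.All Proper Bs →
  2 ^ d * (3 * length Bs + total girth Bs) ≤ 4 * total volume Bs + 2 ^ d * (2 * d) * length Bs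
total-girth-volume {d} [] = ≤-reflexive (trans (*-zeroʳ (2 ^ d)) (sym (*-zeroʳ (2 ^ d * (2 * d)))))
total-girth-volume {d} {B ∷ Bs} (p ∷ ps) = begin
  2 ^ d * (3 * suc (length Bs) + (girth B + total girth Bs))
    ≡⟨ splitˡ (2 ^ d) (length Bs) (girth B) (total girth Bs) ⟩
  2 ^ d * (3 + girth B) + 2 ^ d * (3 * length Bs + total girth Bs)
    ≤⟨ +-mono-≤ (girth-volume p) (total-girth-volume ps) ⟩
  4 * volume B + c + (4 * total volume Bs + c * length Bs)
    ≡⟨ splitʳ c (length Bs) (volume B) (total volume Bs) ⟩
  4 * (volume B + total volume Bs) + c * suc (length Bs) ∎
  where
  open ≤-Reasoning
  c = 2 ^ d * (2 * d)
  splitˡ : ∀ c m g h → c * (3 * suc m + (g + h)) ≡ c * (3 + g) + c * (3 * m + h)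
  splitˡ = solve-∀
  splitʳ : ∀ c m v w → 4 * v + c + (4 * w + c * m) ≡ 4 * (v + w) + c * suc m
  splitʳ = solve-∀

-- The recursive inequality and its numerical consequences.

f-recursion : ∀ d → let e = suc d in
  2 ^ e * (3 * f e + e * (3 * f d)) ≤ 4 * (3 ^ e * 2) + 2 ^ e * (2 * e) * f e
f-recursion d with f (suc d) | f-isMinimum (suc d)
-- A cover of minimum size turns `f e` into `length Bs` on both sides.
... | _ | (Bs , cover@(proper , twice) , refl) , _ = begin
  2 ^ e * (3 * length Bs + e * (3 * f d))
    ≤⟨ *-monoʳ-≤ (2 ^ e) (+-monoʳ-≤ (3 * length Bs) (total-girth cover)) ⟩
  2 ^ e * (3 * length Bs + total girth Bs)
    ≤⟨ total-girth-volume proper ⟩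
  4 * total volume Bs + 2 ^ e * (2 * e) * length Bs
    ≡⟨ cong (λ v → 4 * v + 2 ^ e * (2 * e) * length Bs) (total-volume Bs twice) ⟩
  4 * (3 ^ e * 2) + 2 ^ e * (2 * e) * length Bs ∎
  where
  open ≤-Reasoning
  e = suc d

f3≥11⇒f4≥19 : f 3 ≥ 11 → f 4 ≥ 19
f3≥11⇒f4≥19 f3≥11 = *-cancelˡ-< 80 18 (f 4)
  -- Cancellation leaves `1464 ≤ 80 * f 4`, with `1464 = 16 * 132 - 648`, while `80 * 18 = 1440`.
  (<-≤-trans (from-yes (1441 ≤? 1464)) (+-cancelˡ-≤ (48 * f 4 + 648) 1464 (80 * f 4) (begin
  48 * f 4 + 648 + 1464             ≡⟨ expand (f 4) ⟩
  16 * (3 * f 4 + 4 * (3 * 11))     ≤⟨ *-monoʳ-≤ 16 (+-monoʳ-≤ (3 * f 4) (*-monoʳ-≤ 4 (*-monoʳ-≤ 3 f3≥11))) ⟩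
  16 * (3 * f 4 + 4 * (3 * f 3))    ≤⟨ f-recursion 3 ⟩
  648 + 128 * f 4                   ≡⟨ collect (f 4) ⟩
  48 * f 4 + 648 + 80 * f 4         ∎)))
  where
  open ≤-Reasoning
  expand : ∀ m → 48 * m + 648 + 1464 ≡ 16 * (3 * m + 4 * (3 * 11))
  expand = solve-∀
  collect : ∀ m → 648 + 128 * m ≡ 48 * m + 648 + 80 * m
  collect = solve-∀

-- The exact value 19 matters: the same inequality with 18 in its place would give only `f 5 ≥ 30`,
-- short of `2 ^ 5`.
f4≥19⇒f5≥33 : f 4 ≥ 19 → f 5 ≥ 33
f4≥19⇒f5≥33 f4≥19 = *-cancelˡ-< 224 32 (f 5)
  -- Here `7176 = 32 * 285 - 1944` and `224 * 32 = 7168`, a margin of 8.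
  (<-≤-trans (from-yes (7169 ≤? 7176)) (+-cancelˡ-≤ (96 * f 5 + 1944) 7176 (224 * f 5) (begin
  96 * f 5 + 1944 + 7176            ≡⟨ expand (f 5) ⟩
  32 * (3 * f 5 + 5 * (3 * 19))     ≤⟨ *-monoʳ-≤ 32 (+-monoʳ-≤ (3 * f 5) (*-monoʳ-≤ 5 (*-monoʳ-≤ 3 f4≥19))) ⟩
  32 * (3 * f 5 + 5 * (3 * f 4))    ≤⟨ f-recursion 4 ⟩
  1944 + 320 * f 5                  ≡⟨ collect (f 5) ⟩
  96 * f 5 + 1944 + 224 * f 5       ∎)))
  where
  open ≤-Reasoning
  expand : ∀ m → 96 * m + 1944 + 7176 ≡ 32 * (3 * m + 5 * (3 * 19))
  expand = solve-∀
  collect : ∀ m → 1944 + 320 * m ≡ 96 * m + 1944 + 224 * m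
  collect = solve-∀

corollary4p4 : f 3 ≡ 11 →
    (f 4 ≥ 19 × 19 > 16 × 16 ≡ 2 ^ 4) ×
    (f 5 ≥ 33 × 33 > 32 × 32 ≡ 2 ^ 5) ×
    (f 4 ≥ 2 ^ 4 × f 5 ≥ 2 ^ 5)
corollary4p4 f3≡11 =
  (f4≥19 , from-yes (17 ≤? 19) , refl) ,
  (f5≥33 , n<1+n 32 , refl) ,
  (≤-trans (from-yes (16 ≤? 19)) f4≥19 , ≤-trans (n≤1+n 32) f5≥33)
  where
  f4≥19 = f3≥11⇒f4≥19 (≤-reflexive (sym f3≡11))
  f5≥33 = f4≥19⇒f5≥33 f4≥19
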